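{- In the single-community information cascade model with correct action $A$, signal strength $p>\tfrac12$ and reward $R$ for the correct action, consider the subsidy scheme described in the context (applied after an incorrect cascade on $B$ has begun). In expectation, the subsidy is provided over fewer than $\dfrac{4}{2p-1}$ rounds and totals no more than $R\,\dfrac{4}{2p-1}$.
   Context: Agents $t=1,2,\dots,T$ act sequentially, each choosing $A$ or $B$. Either $A$ is the correct action (event $\mathbf E_A$) or $B$ is (event $\mathbf E_B$); agents have a uniform prior; here $A$ is in truth correct. Choosing the correct action gives reward $R$, the other gives $0$. Agent $t$ receives a private signal $s_t\in\{A,B\}$, equal to the correct action with probability $p$ and to the other with probability $1-p$, and observes the actions of all preceding agents. $|A|$ and $|B|$ denote the numbers of past choices of $A$ and $B$ made outside of a cascade, i.e. by agents who chose an action if and only if it was their signal; these choices form the relevant history $\bar H_{t-1}$, and the posterior of agent $t$ is $$\Pr[\mathbf E_A\mid s_t,\bar H_{t-1}]=\frac{\Pr[s_t\mid\mathbf E_A]\Pr[\bar H_{t-1}\mid\mathbf E_A]}{\sum_{w\in\{A,B\}}\Pr[s_t\mid\mathbf E_w]\Pr[\bar H_{t-1}\mid\mathbf E_w]}.$$ A subsidy $r_t$ for action $A$ is received by agent $t$ if it chooses $A$, regardless of which world is true. Agent $t$ chooses $A$ if $r_t+R\Pr[\mathbf E_A\mid s_t,\bar H_{t-1}]>R\Pr[\mathbf E_B\mid s_t,\bar H_{t-1}]$, chooses $B$ if the reverse strict inequality holds, and follows its signal if indifferent. Agents cannot infer from the subsidy which action is correct. A cascade occurs when an agent's action does not depend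 on its private signal; without subsidy this happens when $|A|-|B|\ge2$ (correct cascade) or $|A|-|B|\le-2$ (incorrect cascade). Subsidy scheme: from some time $t''$ at or after the start of the incorrect cascade, with $T-t''$ much larger than $\frac{4}{2p-1}$, at each time $t\ge t''$: if $|A|-|B|\le-2$, offer for action $A$ the subsidy $$r_t=R\left(\frac{\gamma_t-1}{1+\frac{1-p}{p}\gamma_t}\right),\qquad \gamma_t=\left(\frac{1-p}{p}\right)^{2|A|-t}\frac{1-p}{p};$$ otherwise $r_t=0$. Here $\gamma_t$ is the likelihood ratio $\Pr[\bar H_{t-1}\mid\mathbf E_B]/\Pr[\bar H_{t-1}\mid\mathbf E_A]$, with $t-1$ counting the agents in that history, $|B|=t-1-|A|$. After agent $t$ acts, if $|A|-|B|\le1$, the count of the chosen action is increased by one.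
   Formalization: The subsidy's numerator is corrected from γ_t − 1 to ((1−p)/p)γ_t − 1, which makes an agent with signal A indifferent; with γ_t − 1 the total bound fails (p = 9/10, |A|−|B| = −2: first payment 8R > 5R). Also p < 1 and R > 0. -}

module Defs where

open import Level using (suc; _⊔_)
open import Algebra.Bundles using (CommutativeRing; Semiring)
open import Algebra.Core using (Op₁; Op₂)
open import Algebra.Structures using (IsCommutativeRing)
open import Data.Integer.Base as ℤ using (ℤ; +_; -[1+_])
import Data.Integer.Properties as ℤₚ
open import Data.List.Base using (List; []; _∷_; length; filter)
open import Data.Nat.Base as ℕ using (ℕ; zero)
open import Data.Product.Base using (_×_)
open import Data.Vec.Base as Vec using (Vec; []; _∷_)
open import Relation.Binary.Core using (Rel)
open import Relation.Binary.Definitions using (DecidableEquality; Tri; tri<; tri≈; tri>)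
open import Relation.Binary.PropositionalEquality.Core using (_≡_; refl)
open import Relation.Binary.Structures using (IsStrictTotalOrder)
import Relation.Binary.Construct.StrictToNonStrict as NonStrict
open import Relation.Nullary.Decidable.Core using (Dec; yes; no; _×-dec_)
open import Relation.Nullary.Negation.Core using (¬_)

-- Linearly ordered fields; classically ℝ is one.  The inverse is total, and its
-- value at 0# is unconstrained.
record OrderedField c ℓ₁ ℓ₂ : Set (suc (c ⊔ ℓ₁ ⊔ ℓ₂)) where
  infix  9 _⁻¹
  infix  8 -_
  infixl 7 _*_
  infixl 6 _+_
  infix  4 _≈_ _<_
  field
    Carrier            : Set c
    _≈_                : Rel Carrier ℓ₁
    _<_                : Rel Carrier ℓ₂
    _+_                : Op₂ Carrier
    _*_                : Op₂ Carrier
    -_                 : Op₁ Carrier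
    _⁻¹                : Op₁ Carrier
    0#                 : Carrier
    1#                 : Carrier
    isCommutativeRing  : IsCommutativeRing _≈_ _+_ _*_ -_ 0# 1#
    isStrictTotalOrder : IsStrictTotalOrder _≈_ _<_
    0≉1                : ¬ (0# ≈ 1#)
    ⁻¹-cong            : ∀ {x y} → x ≈ y → x ⁻¹ ≈ y ⁻¹
    *-inverseʳ         : ∀ x → ¬ (x ≈ 0#) → x * x ⁻¹ ≈ 1#
    +-monoˡ-<          : ∀ z {x y} → x < y → x + z < y + z
    *-pos              : ∀ {x y} → 0# < x → 0# < y → 0# < x * y

  commutativeRing : CommutativeRing c ℓ₁
  commutativeRing = record { isCommutativeRing = isCommutativeRing }

  open CommutativeRing commutativeRing public using (_-_; semiring)
  open IsStrictTotalOrder isStrictTotalOrder public using (compare)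
  open NonStrict _≈_ _<_ public using (_≤_)
  open import Algebra.Definitions.RawSemiring (Semiring.rawSemiring semiring) public
    using (_^_) renaming (_×_ to _·_)

  infixl 7 _/_
  _/_ : Op₂ Carrier
  x / y = x * y ⁻¹

  ι : ℕ → Carrier
  ι n = n · 1#

  infixr 8 _^ᶻ_
  _^ᶻ_ : Carrier → ℤ → Carrier
  x ^ᶻ (+ n)    = x ^ n
  x ^ᶻ -[1+ n ] = (x ⁻¹) ^ ℕ.suc n

-- Names the actions, the signals and, for a signal or world, the correct action.
data Action : Set where
  A B : Action

_≟ᴬ_ : DecidableEquality Action
A ≟ᴬ A = yes refl
A ≟ᴬ B = no λ ()
B ≟ᴬ A = no λ ()
B ≟ᴬ B = yes refl

-- The choices made outside a cascade, most recent first.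
History : Set
History = List Action

∣_∣[_] : History → Action → ℕ
∣ H ∣[ a ] = length (filter (a ≟ᴬ_) H)

difference : History → ℤ
difference H = + ∣ H ∣[ A ] ℤ.- + ∣ H ∣[ B ]

module Cascade {c ℓ₁ ℓ₂} (F : OrderedField c ℓ₁ ℓ₂)
               (p R : OrderedField.Carrier F) where
  open OrderedField F

  Pr-signal[_∣_] : Action → Action → Carrier
  Pr-signal[ A ∣ A ] = p
  Pr-signal[ A ∣ B ] = 1# - p
  Pr-signal[ B ∣ A ] = 1# - p
  Pr-signal[ B ∣ B ] = p

  -- A choice made outside a cascade equals the signal of the agent who made it.
  Pr-history[_∣_] : History → Action → Carrier
  Pr-history[ []    ∣ w ] = 1#
  Pr-history[ a ∷ H ∣ w ] = Pr-signal[ a ∣ w ] * Pr-history[ H ∣ w ]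

  joint : Action → History → Action → Carrier
  joint s H w = Pr-signal[ s ∣ w ] * Pr-history[ H ∣ w ]

  -- The uniform prior cancels.
  posterior : Action → Action → History → Carrier
  posterior w s H = joint s H w / (joint s H A + joint s H B)

  choose : (r : Carrier) (s : Action) → History → Action
  choose r s H with compare (R * posterior B s H) (r + R * posterior A s H)
  ... | tri< _ _ _ = A
  ... | tri≈ _ _ _ = s
  ... | tri> _ _ _ = B

  FollowsSignal : Carrier → History → Set
  FollowsSignal r H = choose r A H ≡ A × choose r B H ≡ B

  followsSignal? : ∀ r H → Dec (FollowsSignal r H)
  followsSignal? r H = (choose r A H ≟ᴬ A) ×-dec (choose r B H ≟ᴬ B)

  IncorrectCascade : History → Set
  IncorrectCascade H = ∀ s → choose 0# s H ≡ B

  stepUnsubsidised : History → Action → History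
  stepUnsubsidised H s with followsSignal? 0# H
  ... | yes _ = choose 0# s H ∷ H
  ... | no  _ = H

  -- Signals are listed in the order in which the agents act.
  unsubsidised : ∀ {n} → Vec Action n → History
  unsubsidised = Vec.foldl (λ _ → History) stepUnsubsidised []

  x : Carrier
  x = (1# - p) / p

  -- The index t is one more than the number of agents in the relevant history,
  -- so the exponent 2|A| - t + 1 is |A| - |B|.
  γ : History → Carrier
  γ H = x ^ᶻ (+ (2 ℕ.* ∣ H ∣[ A ]) ℤ.- + t) * x
    where t = ℕ.suc (length H)

  offered? : ∀ H → Dec (difference H ℤ.≤ ℤ.- + 2)
  offered? H = difference H ℤₚ.≤? ℤ.- + 2

  -- An agent with signal A believes A with probability 1 / (1 + xγ) and B with
  -- probability xγ / (1 + xγ); the subsidy is R times the difference, which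
  -- makes that agent indifferent.  The source displays the numerator as γ - 1,
  -- without the factor x.  That slip is corrected here: with γ - 1, if p = 9/10
  -- and |A| - |B| = -2, then γ = 81 and the subsidy is 8R, which both signals
  -- accept, so one round costs more than the claimed total 4R / (2p - 1) = 5R,
  -- and the choice recorded in the history no longer reveals the signal.
  subsidy : History → Carrier
  subsidy H with offered? H
  ... | yes _ = R * ((x * γ H - 1#) / (1# + x * γ H))
  ... | no  _ = 0#

  step : History → Action → History
  step H s with difference H ℤₚ.≤? + 1
  ... | yes _ = choose (subsidy H) s H ∷ H
  ... | no  _ = H

  offers : History → ℕ
  offers H with offered? H
  ... | yes _ = 1
  ... | no  _ = 0

  paid : History → Action → Carrier
  paid H s with choose (subsidy H) s H
  ... | A = subsidy H
  ... | B = 0#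

  subsidisedRounds : ∀ {n} → History → Vec Action n → ℕ
  subsidisedRounds H []       = 0
  subsidisedRounds H (s ∷ ss) = offers H ℕ.+ subsidisedRounds (step H s) ss

  totalSubsidy : ∀ {n} → History → Vec Action n → Carrier
  totalSubsidy H []       = 0#
  totalSubsidy H (s ∷ ss) = paid H s + totalSubsidy (step H s) ss

  -- Expectation over n independent signals when A is the correct action.
  𝔼 : ∀ n → (Vec Action n → Carrier) → Carrier
  𝔼 zero      f = f []
  𝔼 (ℕ.suc n) f = Pr-signal[ A ∣ A ] * 𝔼 n (λ ss → f (A ∷ ss))
                + Pr-signal[ B ∣ A ] * 𝔼 n (λ ss → f (B ∷ ss))

-- While |A| - |B| ≤ -2 the subsidy makes an agent with signal A exactly
-- indifferent, so every agent with |A| - |B| ≤ 1 follows her signal, and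
-- |A| - |B| is a random walk with drift 2p - 1 > 0 that is absorbed at 2.  With
-- k = 2 - (|A| - |B|), the value k / (2p - 1) exceeds its expectation after one
-- more round by exactly one round as long as k ≥ 1, so it bounds the expected
-- number of rounds before absorption, strictly at every finite horizon.  An
-- incorrect cascade starts at |A| - |B| = -2, that is k = 4, and each round costs
-- at most R.
module Submission where

open import Defs
open import Algebra.Bundles using (CommutativeRing)
import Algebra.Properties.Ring as RingProperties
import Algebra.Solver.Ring.NaturalCoefficients.Default as SemiringSolver
open import Data.Integer.Base as ℤ using (ℤ; +_; -[1+_])
import Data.Integer.Properties as ℤₚ
open import Data.Integer.Tactic.RingSolver using (solve-∀)
open import Data.List.Base using ([]; _∷_; length)
open import Data.Nat.Base as ℕ using (ℕ; zero; suc; _∸_; s≤s)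
import Data.Nat.Properties as ℕₚ
open import Data.Product.Base using (_×_; _,_)
open import Data.Sum.Base using (inj₁; inj₂)
open import Data.Vec.Base as Vec using (Vec; []; _∷_)
open import Relation.Binary.Bundles using (StrictTotalOrder)
open import Relation.Binary.Definitions using (tri<; tri≈; tri>)
open import Relation.Binary.PropositionalEquality as ≡ using (_≡_)
import Relation.Binary.Reasoning.StrictPartialOrder as StrictPartialOrderReasoning
open import Relation.Nullary.Decidable.Core using (yes; no)
open import Relation.Nullary.Negation.Core using (¬_; contradiction)

-- Arithmetic in ordered fields.

module OrderedFieldProperties {c ℓ₁ ℓ₂} (F : OrderedField c ℓ₁ ℓ₂) where
  open OrderedField F
  open CommutativeRing commutativeRing public
    using (refl; sym; trans; reflexive; +-cong; +-congˡ; +-congʳ; +-assoc; +-comm; +-identityˡ;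
           +-identityʳ; *-cong; *-congˡ; *-congʳ; *-assoc; *-comm; *-identityˡ;
           *-identityʳ; distribˡ; distribʳ; zeroˡ; zeroʳ; -‿inverseˡ; -‿inverseʳ)

  strictTotalOrder : StrictTotalOrder c ℓ₁ ℓ₂
  strictTotalOrder = record { isStrictTotalOrder = isStrictTotalOrder }

  open StrictTotalOrder strictTotalOrder public
    using (<-respˡ-≈; <-respʳ-≈; irrefl) renaming (trans to <-trans)
  module ≤-Reasoning =
    StrictPartialOrderReasoning (StrictTotalOrder.strictPartialOrder strictTotalOrder)
  open ≤-Reasoning
  open SemiringSolver (CommutativeRing.commutativeSemiring commutativeRing) public
    using (solve; con; _:+_; _:*_; _:=_)

  x-y+y≈x : ∀ x y → x - y + y ≈ x
  x-y+y≈x x y = begin-equality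
    x + - y + y    ≈⟨ +-assoc x (- y) y ⟩
    x + (- y + y)  ≈⟨ +-congˡ (-‿inverseˡ y) ⟩
    x + 0#         ≈⟨ +-identityʳ x ⟩
    x              ∎

  x+y-y≈x : ∀ x y → x + y - y ≈ x
  x+y-y≈x x y = begin-equality
    x + y + - y    ≈⟨ +-assoc x y (- y) ⟩
    x + (y + - y)  ≈⟨ +-congˡ (-‿inverseʳ y) ⟩
    x + 0#         ≈⟨ +-identityʳ x ⟩
    x              ∎

  +-monoʳ-< : ∀ z {x y} → x < y → z + x < z + y
  +-monoʳ-< z {x} {y} x<y = begin-strict
    z + x  ≈⟨ +-comm z x ⟩
    x + z  <⟨ +-monoˡ-< z x<y ⟩
    y + z  ≈⟨ +-comm y z ⟩
    z + y  ∎

  +-monoˡ-≤ : ∀ z {x y} → x ≤ y → x + z ≤ y + z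
  +-monoˡ-≤ z (inj₁ x<y) = inj₁ (+-monoˡ-< z x<y)
  +-monoˡ-≤ z (inj₂ x≈y) = inj₂ (+-congʳ x≈y)

  +-monoʳ-≤ : ∀ z {x y} → x ≤ y → z + x ≤ z + y
  +-monoʳ-≤ z (inj₁ x<y) = inj₁ (+-monoʳ-< z x<y)
  +-monoʳ-≤ z (inj₂ x≈y) = inj₂ (+-congˡ x≈y)

  +-mono-≤ : ∀ {w x y z} → w ≤ x → y ≤ z → w + y ≤ x + z
  +-mono-≤ {w} {x} {y} {z} w≤x y≤z = begin
    w + y  ≤⟨ +-monoˡ-≤ y w≤x ⟩
    x + y  ≤⟨ +-monoʳ-≤ x y≤z ⟩
    x + z  ∎

  +-mono-≤-< : ∀ {w x y z} → w ≤ x → y < z → w + y < x + z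
  +-mono-≤-< {w} {x} {y} {z} w≤x y<z = begin-strict
    w + y  ≤⟨ +-monoˡ-≤ y w≤x ⟩
    x + y  <⟨ +-monoʳ-< x y<z ⟩
    x + z  ∎

  +-pos : ∀ {x y} → 0# < x → 0# < y → 0# < x + y
  +-pos {x} {y} 0<x 0<y = begin-strict
    0#       ≈⟨ +-identityˡ 0# ⟨
    0# + 0#  <⟨ +-mono-≤-< (inj₁ 0<x) 0<y ⟩
    x + y    ∎

  x<y⇒0<y-x : ∀ {x y} → x < y → 0# < y - x
  x<y⇒0<y-x {x} {y} x<y = begin-strict
    0#     ≈⟨ -‿inverseʳ x ⟨
    x - x  <⟨ +-monoˡ-< (- x) x<y ⟩
    y - x  ∎

  *-monoˡ-< : ∀ {z x y} → 0# < z → x < y → x * z < y * z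
  *-monoˡ-< {z} {x} {y} 0<z x<y = begin-strict
    x * z                ≈⟨ +-identityˡ (x * z) ⟨
    0# + x * z           <⟨ +-monoˡ-< (x * z) (*-pos (x<y⇒0<y-x x<y) 0<z) ⟩
    (y - x) * z + x * z  ≈⟨ distribʳ z (y - x) x ⟨
    (y - x + x) * z      ≈⟨ *-congʳ (x-y+y≈x y x) ⟩
    y * z                ∎

  *-monoʳ-< : ∀ {z x y} → 0# < z → x < y → z * x < z * y
  *-monoʳ-< {z} {x} {y} 0<z x<y = begin-strict
    z * x  ≈⟨ *-comm z x ⟩
    x * z  <⟨ *-monoˡ-< 0<z x<y ⟩
    y * z  ≈⟨ *-comm y z ⟩
    z * y  ∎

  *-monoʳ-≤ : ∀ {z x y} → 0# < z → x ≤ y → z * x ≤ z * y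
  *-monoʳ-≤ 0<z (inj₁ x<y) = inj₁ (*-monoʳ-< 0<z x<y)
  *-monoʳ-≤ 0<z (inj₂ x≈y) = inj₂ (*-congˡ x≈y)

  *-mono-<-pos : ∀ {w x y z} → 0# < x → 0# < y → w < x → y < z → w * y < x * z
  *-mono-<-pos {w} {x} {y} {z} 0<x 0<y w<x y<z = begin-strict
    w * y  <⟨ *-monoˡ-< 0<y w<x ⟩
    x * y  <⟨ *-monoʳ-< 0<x y<z ⟩
    x * z  ∎

  <⇒≉ : ∀ {x y} → x < y → ¬ (y ≈ x)
  <⇒≉ x<y y≈x = irrefl (sym y≈x) x<y

  0<1 : 0# < 1#
  0<1 with compare 0# 1#
  ... | tri< 0<1 _ _ = 0<1
  ... | tri≈ _ 0≈1 _ = contradiction 0≈1 0≉1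
  ... | tri> _ _ 1<0 = <-respʳ-≈ -1*-1≈1 (*-pos 0<-1 0<-1)
    where
    open RingProperties (CommutativeRing.ring commutativeRing)
    0<-1 : 0# < - 1#
    0<-1 = <-respʳ-≈ (+-identityˡ (- 1#)) (x<y⇒0<y-x 1<0)
    -1*-1≈1 : - 1# * - 1# ≈ 1#
    -1*-1≈1 = trans (-1*x≈-x (- 1#)) (-‿involutive 1#)

  0≤ι : ∀ n → 0# ≤ ι n
  0≤ι zero    = inj₂ refl
  0≤ι (suc n) = begin
    0#        ≈⟨ +-identityˡ 0# ⟨
    0# + 0#   ≤⟨ +-mono-≤ (inj₁ 0<1) (0≤ι n) ⟩
    1# + ι n  ∎

  0<ι-suc : ∀ n → 0# < ι (suc n)
  0<ι-suc n = begin-strict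
    0#         <⟨ 0<1 ⟩
    1#         ≈⟨ +-identityʳ 1# ⟨
    1# + 0#    ≤⟨ +-monoʳ-≤ 1# (0≤ι n) ⟩
    ι (suc n)  ∎

  ι-+ : ∀ m n → ι (m ℕ.+ n) ≈ ι m + ι n
  ι-+ zero    n = sym (+-identityˡ (ι n))
  ι-+ (suc m) n = trans (+-congˡ (ι-+ m n)) (sym (+-assoc 1# (ι m) (ι n)))

  x*x⁻¹≈1 : ∀ {x} → 0# < x → x * x ⁻¹ ≈ 1#
  x*x⁻¹≈1 0<x = *-inverseʳ _ (<⇒≉ 0<x)

  ⁻¹-pos : ∀ {x} → 0# < x → 0# < x ⁻¹
  ⁻¹-pos {x} 0<x with compare 0# (x ⁻¹)
  ... | tri< 0<x⁻¹ _ _ = 0<x⁻¹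
  ... | tri≈ _ 0≈x⁻¹ _ = contradiction
    (trans (sym (zeroʳ x)) (trans (*-congˡ 0≈x⁻¹) (x*x⁻¹≈1 0<x))) 0≉1
  ... | tri> _ _ x⁻¹<0 = contradiction (<-trans 0<1 1<0) (irrefl refl)
    where
    1<0 : 1# < 0#
    1<0 = begin-strict
      1#        ≈⟨ x*x⁻¹≈1 0<x ⟨
      x * x ⁻¹  <⟨ *-monoʳ-< 0<x x⁻¹<0 ⟩
      x * 0#    ≈⟨ zeroʳ x ⟩
      0#        ∎

  /-pos : ∀ {x y} → 0# < x → 0# < y → 0# < x / y
  /-pos 0<x 0<y = *-pos 0<x (⁻¹-pos 0<y)

  x/y*y≈x : ∀ {y} x → 0# < y → (x / y) * y ≈ x
  x/y*y≈x {y} x 0<y = begin-equality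
    x * y ⁻¹ * y    ≈⟨ solve 3 (λ x y z → x :* z :* y := x :* (y :* z)) refl x y (y ⁻¹) ⟩
    x * (y * y ⁻¹)  ≈⟨ *-congˡ (x*x⁻¹≈1 0<y) ⟩
    x * 1#          ≈⟨ *-identityʳ x ⟩
    x               ∎

  x≈[x*y]*y⁻¹ : ∀ {y} x → 0# < y → x ≈ (x * y) * y ⁻¹
  x≈[x*y]*y⁻¹ {y} x 0<y = begin-equality
    x               ≈⟨ x/y*y≈x x 0<y ⟨
    x * y ⁻¹ * y    ≈⟨ solve 3 (λ x y z → x :* z :* y := x :* y :* z) refl x y (y ⁻¹) ⟩
    (x * y) * y ⁻¹  ∎

  -- Puts two fractions over the same factor, so that cross-multiplied inequalities and equalities
  -- transfer to quotients.
  /-common-denominator : ∀ {y z} x → 0# < z → x / y ≈ (x * z) * (y ⁻¹ * z ⁻¹)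
  /-common-denominator {y} {z} x 0<z = begin-equality
    x * y ⁻¹                 ≈⟨ *-congʳ (x≈[x*y]*y⁻¹ x 0<z) ⟩
    x * z * z ⁻¹ * y ⁻¹
      ≈⟨ solve 3 (λ u v w → u :* w :* v := u :* (v :* w)) refl (x * z) (y ⁻¹) (z ⁻¹) ⟩
    x * z * (y ⁻¹ * z ⁻¹)    ∎

  /-mono-cross-< : ∀ {u v x y} → 0# < v → 0# < y → u * y < x * v → u / v < x / y
  /-mono-cross-< {u} {v} {x} {y} 0<v 0<y uy<xv = begin-strict
    u / v                  ≈⟨ /-common-denominator u 0<y ⟩
    u * y * (v ⁻¹ * y ⁻¹)  <⟨ *-monoˡ-< (*-pos (⁻¹-pos 0<v) (⁻¹-pos 0<y)) uy<xv ⟩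
    x * v * (v ⁻¹ * y ⁻¹)  ≈⟨ *-congˡ (*-comm (v ⁻¹) (y ⁻¹)) ⟩
    x * v * (y ⁻¹ * v ⁻¹)  ≈⟨ /-common-denominator x 0<v ⟨
    x / y                  ∎

  /-cong-cross : ∀ {u v x y} → 0# < v → 0# < y → u * y ≈ x * v → u / v ≈ x / y
  /-cong-cross {u} {v} {x} {y} 0<v 0<y uy≈xv = begin-equality
    u / v                  ≈⟨ /-common-denominator u 0<y ⟩
    u * y * (v ⁻¹ * y ⁻¹)  ≈⟨ *-cong uy≈xv (*-comm (v ⁻¹) (y ⁻¹)) ⟩
    x * v * (y ⁻¹ * v ⁻¹)  ≈⟨ /-common-denominator x 0<v ⟨
    x / y                  ∎

  ^-<1 : ∀ {x} → 0# < x → x < 1# → ∀ n → x ^ suc n < 1#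
  ^-<1 {x} 0<x x<1 zero    = <-respˡ-≈ (sym (*-identityʳ x)) x<1
  ^-<1 {x} 0<x x<1 (suc n) = begin-strict
    x * x ^ suc n  <⟨ *-monoʳ-< 0<x (^-<1 0<x x<1 n) ⟩
    x * 1#         ≈⟨ *-identityʳ x ⟩
    x              <⟨ x<1 ⟩
    1#             ∎

  1<-^ : ∀ {x} → 1# < x → ∀ n → 1# < x ^ suc n
  1<-^ {x} 1<x zero    = <-respʳ-≈ (sym (*-identityʳ x)) 1<x
  1<-^ {x} 1<x (suc n) = begin-strict
    1#             <⟨ 1<x ⟩
    x              ≈⟨ *-identityʳ x ⟨
    x * 1#         <⟨ *-monoʳ-< (<-trans 0<1 1<x) (1<-^ 1<x n) ⟩
    x * x ^ suc n  ∎

  -- Negative powers are powers of `x ⁻¹`, so raising a negative exponent cancels one pair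
  -- `x * x ⁻¹`; the passage from -1 to 0 is a case of its own because the encoding of `ℤ` changes
  -- there.
  ^ᶻ-suc : ∀ {x} → 0# < x → ∀ i → x ^ᶻ ℤ.suc i ≈ x * x ^ᶻ i
  ^ᶻ-suc     0<x (+ n)        = refl
  ^ᶻ-suc {x} 0<x -[1+ zero ]  = begin-equality
    1#               ≈⟨ x*x⁻¹≈1 0<x ⟨
    x * x ⁻¹         ≈⟨ *-congˡ (*-identityʳ (x ⁻¹)) ⟨
    x * (x ⁻¹ * 1#)  ∎
  ^ᶻ-suc {x} 0<x -[1+ suc n ] = begin-equality
    y              ≈⟨ *-identityˡ y ⟨
    1# * y         ≈⟨ *-congʳ (x*x⁻¹≈1 0<x) ⟨
    x * x ⁻¹ * y   ≈⟨ *-assoc x (x ⁻¹) y ⟩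
    x * (x ⁻¹ * y) ∎
    where
    y : Carrier
    y = (x ⁻¹) ^ suc n

-- The difference of the two counts and the exponent in `γ`.

difference-A : ∀ H → difference (A ∷ H) ≡ ℤ.suc (difference H)
difference-A H = ℤₚ.+-assoc (+ 1) (+ ∣ H ∣[ A ]) (ℤ.- + ∣ H ∣[ B ])

difference-B : ∀ H → difference (B ∷ H) ≡ ℤ.pred (difference H)
difference-B H = lemma (+ ∣ H ∣[ A ]) (+ ∣ H ∣[ B ])
  where
  lemma : ∀ i j → i ℤ.- (+ 1 ℤ.+ j) ≡ ℤ.- + 1 ℤ.+ (i ℤ.- j)
  lemma = solve-∀

-- The length is |A| + |B|, so 2|A| minus the length is the difference. The outer `ℤ.suc` stands for
-- the separate factor `x` in `γ` and offsets the index being one more than the length.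
exponent≡difference : ∀ H →
  ℤ.suc (+ (2 ℕ.* ∣ H ∣[ A ]) ℤ.- + suc (length H)) ≡ difference H
exponent≡difference []      = ≡.refl
exponent≡difference (A ∷ H) = begin
  ℤ.suc (+ (2 ℕ.* suc a) ℤ.- + suc (suc l))
    ≡⟨ ≡.cong (λ n → ℤ.suc (+ n ℤ.- + suc (suc l))) (ℕₚ.*-suc 2 a) ⟩
  ℤ.suc ((+ 2 ℤ.+ + (2 ℕ.* a)) ℤ.- (+ 1 ℤ.+ + suc l))  ≡⟨ lemma (+ (2 ℕ.* a)) (+ suc l) ⟩
  ℤ.suc (ℤ.suc (+ (2 ℕ.* a) ℤ.- + suc l))     ≡⟨ ≡.cong ℤ.suc (exponent≡difference H) ⟩
  ℤ.suc (difference H)                        ≡⟨ difference-A H ⟨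
  difference (A ∷ H)                          ∎
  where
  open ≡.≡-Reasoning
  a l : ℕ
  a = ∣ H ∣[ A ]
  l = length H
  lemma : ∀ i j → + 1 ℤ.+ ((+ 2 ℤ.+ i) ℤ.- (+ 1 ℤ.+ j)) ≡ + 1 ℤ.+ (+ 1 ℤ.+ (i ℤ.- j))
  lemma = solve-∀
exponent≡difference (B ∷ H) = begin
  ℤ.suc (+ (2 ℕ.* a) ℤ.- (+ 1 ℤ.+ + suc l))  ≡⟨ lemma (+ (2 ℕ.* a)) (+ suc l) ⟩
  ℤ.pred (ℤ.suc (+ (2 ℕ.* a) ℤ.- + suc l))   ≡⟨ ≡.cong ℤ.pred (exponent≡difference H) ⟩
  ℤ.pred (difference H)                      ≡⟨ difference-B H ⟨
  difference (B ∷ H)                         ∎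
  where
  open ≡.≡-Reasoning
  a l : ℕ
  a = ∣ H ∣[ A ]
  l = length H
  lemma : ∀ i j → + 1 ℤ.+ (i ℤ.- (+ 1 ℤ.+ j)) ≡ ℤ.- + 1 ℤ.+ (+ 1 ℤ.+ (i ℤ.- j))
  lemma = solve-∀

module CascadeProperties
  {c ℓ₁ ℓ₂} (F : OrderedField c ℓ₁ ℓ₂) (p R : OrderedField.Carrier F)
  (½<p : OrderedField._<_ F (OrderedField._/_ F (OrderedField.1# F) (OrderedField.ι F 2)) p)
  (p<1 : OrderedField._<_ F p (OrderedField.1# F))
  (0<R : OrderedField._<_ F (OrderedField.0# F) R) where
  open OrderedField F
  open OrderedFieldProperties F
  open Cascade F p R
  open ≤-Reasoning

  -- Constants derived from the signal strength.

  q μ : Carrier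
  q = 1# - p
  μ = ι 2 * p - 1#

  0<p : 0# < p
  0<p = <-trans (/-pos 0<1 (0<ι-suc 1)) ½<p

  0<q : 0# < q
  0<q = x<y⇒0<y-x p<1

  q+p≈1 : q + p ≈ 1#
  q+p≈1 = x-y+y≈x 1# p

  ι2*p≈p+p : ι 2 * p ≈ p + p
  ι2*p≈p+p = solve 1 (λ p → (con 1 :+ (con 1 :+ con 0)) :* p := p :+ p) refl p

  1<ι2*p : 1# < ι 2 * p
  1<ι2*p = begin-strict
    1#               ≈⟨ x/y*y≈x 1# (0<ι-suc 1) ⟨
    (1# / ι 2) * ι 2 <⟨ *-monoˡ-< (0<ι-suc 1) ½<p ⟩
    p * ι 2          ≈⟨ *-comm p (ι 2) ⟩
    ι 2 * p          ∎

  0<μ : 0# < μ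
  0<μ = x<y⇒0<y-x 1<ι2*p

  -- `μ` is the drift of a walk that goes up with probability `p` and down with probability `q`;
  -- without subtraction, the fact can enter semiring calculations.
  μ+q≈p : μ + q ≈ p
  μ+q≈p = begin-equality
    μ + (1# - p)  ≈⟨ +-assoc μ 1# (- p) ⟨
    μ + 1# - p    ≈⟨ +-congʳ (x-y+y≈x (ι 2 * p) 1#) ⟩
    ι 2 * p - p   ≈⟨ +-congʳ ι2*p≈p+p ⟩
    p + p - p     ≈⟨ x+y-y≈x p p ⟩
    p             ∎

  q<p : q < p
  q<p = begin-strict
    q       ≈⟨ +-identityˡ q ⟨
    0# + q  <⟨ +-monoˡ-< q 0<μ ⟩
    μ + q   ≈⟨ μ+q≈p ⟩
    p       ∎

  q*q<p*p : q * q < p * p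
  q*q<p*p = *-mono-<-pos 0<p 0<q q<p q<p

  0<x : 0# < x
  0<x = /-pos 0<q 0<p

  x*p≈q : x * p ≈ q
  x*p≈q = x/y*y≈x q 0<p

  x<1 : x < 1#
  x<1 = begin-strict
    q * p ⁻¹  <⟨ *-monoˡ-< (⁻¹-pos 0<p) q<p ⟩
    p * p ⁻¹  ≈⟨ x*x⁻¹≈1 0<p ⟩
    1#        ∎

  1<x⁻¹ : 1# < x ⁻¹
  1<x⁻¹ = begin-strict
    1#        ≈⟨ x*x⁻¹≈1 0<x ⟨
    x * x ⁻¹  <⟨ *-monoˡ-< (⁻¹-pos 0<x) x<1 ⟩
    1# * x ⁻¹ ≈⟨ *-identityˡ (x ⁻¹) ⟩
    x ⁻¹      ∎

  -- Beliefs

  0<Pr-signal : ∀ s w → 0# < Pr-signal[ s ∣ w ]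
  0<Pr-signal A A = 0<p
  0<Pr-signal A B = 0<q
  0<Pr-signal B A = 0<q
  0<Pr-signal B B = 0<p

  0<Pr-history : ∀ H w → 0# < Pr-history[ H ∣ w ]
  0<Pr-history []      w = 0<1
  0<Pr-history (a ∷ H) w = *-pos (0<Pr-signal a w) (0<Pr-history H w)

  evidence : Action → History → Carrier
  evidence s H = joint s H A + joint s H B

  0<evidence : ∀ s H → 0# < evidence s H
  0<evidence s H = +-pos (0<Pr-history (s ∷ H) A) (0<Pr-history (s ∷ H) B)

  -- A choice of `A` multiplies the likelihood ratio of world `B` to world `A` by `x = q / p`, and a
  -- choice of `B` divides it by `x`. Hence the ratio depends on the history only through the
  -- difference.
  x^difference*Pr-A≈Pr-B : ∀ H →
    x ^ᶻ difference H * Pr-history[ H ∣ A ] ≈ Pr-history[ H ∣ B ]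
  x^difference*Pr-A≈Pr-B []      = *-identityˡ 1#
  x^difference*Pr-A≈Pr-B (A ∷ H) = begin-equality
    x ^ᶻ difference (A ∷ H) * (p * u)  ≡⟨ ≡.cong (λ i → x ^ᶻ i * (p * u)) (difference-A H) ⟩
    x ^ᶻ ℤ.suc d * (p * u)             ≈⟨ *-congʳ (^ᶻ-suc 0<x d) ⟩
    x * x ^ᶻ d * (p * u)
      ≈⟨ solve 4 (λ x y p u → x :* y :* (p :* u) := x :* p :* (y :* u)) refl x (x ^ᶻ d) p u ⟩
    x * p * (x ^ᶻ d * u)               ≈⟨ *-cong x*p≈q (x^difference*Pr-A≈Pr-B H) ⟩
    q * Pr-history[ H ∣ B ]            ∎
    where
    d : ℤ
    d = difference H
    u : Carrier
    u = Pr-history[ H ∣ A ]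
  x^difference*Pr-A≈Pr-B (B ∷ H) = begin-equality
    -- Writing `q` as `x * p` supplies the factor `x` that raises the exponent from `d′` back to the
    -- difference of `H`.
    x ^ᶻ d′ * (q * u)        ≈⟨ *-congˡ (*-congʳ x*p≈q) ⟨
    x ^ᶻ d′ * (x * p * u)
      ≈⟨ solve 4 (λ x y p u → y :* (x :* p :* u) := p :* (x :* y :* u)) refl x (x ^ᶻ d′) p u ⟩
    p * (x * x ^ᶻ d′ * u)    ≈⟨ *-congˡ (*-congʳ (^ᶻ-suc 0<x d′)) ⟨
    p * (x ^ᶻ ℤ.suc d′ * u)  ≡⟨ ≡.cong (λ i → p * (x ^ᶻ i * u)) suc-d′ ⟩
    p * (x ^ᶻ difference H * u)  ≈⟨ *-congˡ (x^difference*Pr-A≈Pr-B H) ⟩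
    p * Pr-history[ H ∣ B ]  ∎
    where
    d′ : ℤ
    d′ = difference (B ∷ H)
    u : Carrier
    u = Pr-history[ H ∣ A ]
    suc-d′ : ℤ.suc d′ ≡ difference H
    suc-d′ = ≡.trans (≡.cong ℤ.suc (difference-B H)) (ℤₚ.suc-pred (difference H))

  x^≤1 : ∀ {i} → + 0 ℤ.≤ i → x ^ᶻ i ≤ 1#
  x^≤1 {+ zero}  _ = inj₂ refl
  x^≤1 {+ suc n} _ = inj₁ (^-<1 0<x x<1 n)

  1<x^ : ∀ {i} → i ℤ.< + 0 → 1# < x ^ᶻ i
  1<x^ { -[1+ n ]} _ = 1<-^ 1<x⁻¹ n
  1<x^ {+ n} (ℤ.+<+ ())

  -- `joint s H w` is by definition `Pr-history[ s ∷ H ∣ w ]`, so this and the next lemma also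
  -- compare an agent's posteriors, her signal counting as one more choice.
  Pr-B≤Pr-A : ∀ H → + 0 ℤ.≤ difference H → Pr-history[ H ∣ B ] ≤ Pr-history[ H ∣ A ]
  Pr-B≤Pr-A H 0≤d = begin
    Pr-history[ H ∣ B ]                      ≈⟨ x^difference*Pr-A≈Pr-B H ⟨
    x ^ᶻ difference H * Pr-history[ H ∣ A ]  ≈⟨ *-comm _ _ ⟩
    Pr-history[ H ∣ A ] * x ^ᶻ difference H  ≤⟨ *-monoʳ-≤ (0<Pr-history H A) (x^≤1 0≤d) ⟩
    Pr-history[ H ∣ A ] * 1#                 ≈⟨ *-identityʳ _ ⟩
    Pr-history[ H ∣ A ]                      ∎

  Pr-A<Pr-B : ∀ H → difference H ℤ.< + 0 → Pr-history[ H ∣ A ] < Pr-history[ H ∣ B ]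
  Pr-A<Pr-B H d<0 = begin-strict
    Pr-history[ H ∣ A ]                      ≈⟨ *-identityˡ _ ⟨
    1# * Pr-history[ H ∣ A ]                 <⟨ *-monoˡ-< (0<Pr-history H A) (1<x^ d<0) ⟩
    x ^ᶻ difference H * Pr-history[ H ∣ A ]  ≈⟨ x^difference*Pr-A≈Pr-B H ⟩
    Pr-history[ H ∣ B ]                      ∎

  -- Choices

  choose-< : ∀ r s H → R * posterior B s H < r + R * posterior A s H → choose r s H ≡ A
  choose-< r s H lt with compare (R * posterior B s H) (r + R * posterior A s H)
  ... | tri< _ _ _   = ≡.refl
  ... | tri≈ ¬lt _ _ = contradiction lt ¬lt
  ... | tri> ¬lt _ _ = contradiction lt ¬lt

  choose-≈ : ∀ r s H → R * posterior B s H ≈ r + R * posterior A s H → choose r s H ≡ s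
  choose-≈ r s H eq with compare (R * posterior B s H) (r + R * posterior A s H)
  ... | tri< _ ¬eq _ = contradiction eq ¬eq
  ... | tri≈ _ _ _   = ≡.refl
  ... | tri> _ ¬eq _ = contradiction eq ¬eq

  choose-> : ∀ r s H → r + R * posterior A s H < R * posterior B s H → choose r s H ≡ B
  choose-> r s H gt with compare (R * posterior B s H) (r + R * posterior A s H)
  ... | tri< _ _ ¬gt = contradiction gt ¬gt
  ... | tri≈ _ _ ¬gt = contradiction gt ¬gt
  ... | tri> _ _ _   = ≡.refl

  -- Both posteriors have the same positive denominator `evidence s H`.
  R*posterior-mono-< : ∀ {w w′} s H → joint s H w < joint s H w′ →
    R * posterior w s H < R * posterior w′ s H
  R*posterior-mono-< s H lt = *-monoʳ-< 0<R (*-monoˡ-< (⁻¹-pos (0<evidence s H)) lt)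

  -- Counting the signal brings the difference to at least 0, so `A` is at least as likely as `B`; a
  -- tie is settled by the signal.
  choose-unsubsidised-A : ∀ H → ℤ.- + 1 ℤ.≤ difference H → choose 0# A H ≡ A
  choose-unsubsidised-A H -1≤d with Pr-B≤Pr-A (A ∷ H) 0≤d′
    where
    0≤d′ : + 0 ℤ.≤ difference (A ∷ H)
    0≤d′ = ≡.subst (+ 0 ℤ.≤_) (≡.sym (difference-A H)) (ℤₚ.+-monoʳ-≤ (+ 1) -1≤d)
  ... | inj₁ lt = choose-< 0# A H (<-respʳ-≈ (sym (+-identityˡ _)) (R*posterior-mono-< A H lt))
  ... | inj₂ eq = choose-≈ 0# A H (trans (*-congˡ (*-congʳ eq)) (sym (+-identityˡ _)))

  choose-unsubsidised-<0 : ∀ s H → difference (s ∷ H) ℤ.< + 0 → choose 0# s H ≡ B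
  choose-unsubsidised-<0 s H d<0 = choose-> 0# s H
    (<-respˡ-≈ (sym (+-identityˡ _)) (R*posterior-mono-< s H (Pr-A<Pr-B (s ∷ H) d<0)))

  -- Counting the signal brings the difference to at most 0. It is exactly 0 when it was 1 before,
  -- and then the signal settles the tie.
  choose-unsubsidised-B : ∀ H → difference H ℤ.≤ + 1 → choose 0# B H ≡ B
  choose-unsubsidised-B H d≤1 with ℤₚ.<-cmp (difference (B ∷ H)) (+ 0)
  ... | tri< d′<0 _ _ = choose-unsubsidised-<0 B H d′<0
  ... | tri≈ _ d′≡0 _ = choose-≈ 0# B H (trans (*-congˡ (*-congʳ Pr-B≈Pr-A)) (sym (+-identityˡ _)))
    where
    Pr-B≈Pr-A : joint B H B ≈ joint B H A
    Pr-B≈Pr-A = begin-equality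
      joint B H B                             ≈⟨ x^difference*Pr-A≈Pr-B (B ∷ H) ⟨
      x ^ᶻ difference (B ∷ H) * joint B H A   ≡⟨ ≡.cong (λ i → x ^ᶻ i * joint B H A) d′≡0 ⟩
      1# * joint B H A                        ≈⟨ *-identityˡ _ ⟩
      joint B H A                             ∎
  ... | tri> ¬lt ¬eq 0<d′ = contradiction d′≤0 (ℤₚ.<⇒≱ 0<d′)
    where
    d′≤0 : difference (B ∷ H) ℤ.≤ + 0
    d′≤0 = ≡.subst (ℤ._≤ + 0) (≡.sym (difference-B H)) (ℤₚ.+-monoʳ-≤ (ℤ.- + 1) d≤1)

  γ≈x^difference : ∀ H → γ H ≈ x ^ᶻ difference H
  γ≈x^difference H = begin-equality
    x ^ᶻ e * x         ≈⟨ *-comm (x ^ᶻ e) x ⟩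
    x * x ^ᶻ e         ≈⟨ ^ᶻ-suc 0<x e ⟨
    x ^ᶻ ℤ.suc e       ≡⟨ ≡.cong (x ^ᶻ_) (exponent≡difference H) ⟩
    x ^ᶻ difference H  ∎
    where
    e : ℤ
    e = + (2 ℕ.* ∣ H ∣[ A ]) ℤ.- + suc (length H)

  -- The offer and its effect on each signal.

  module _ (H : History) where
    private
      y jA jB : Carrier
      y  = x * γ H
      jA = joint A H A
      jB = joint A H B

    -- For an agent with signal `A`, `y` is the odds of `B` against `A`: the signal contributes `x`
    -- and the history `γ H`. Her posteriors are therefore 1 / (1 + y) and y / (1 + y).
    xγ*joint-A≈joint-B : y * jA ≈ jB
    xγ*joint-A≈joint-B = begin-equality
      x * γ H * (p * u)
        ≈⟨ solve 4 (λ x g p u → x :* g :* (p :* u) := x :* p :* (g :* u)) refl x (γ H) p u ⟩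
      x * p * (γ H * u)             ≈⟨ *-cong x*p≈q (*-congʳ (γ≈x^difference H)) ⟩
      q * (x ^ᶻ difference H * u)   ≈⟨ *-congˡ (x^difference*Pr-A≈Pr-B H) ⟩
      q * Pr-history[ H ∣ B ]       ∎
      where
      u : Carrier
      u = Pr-history[ H ∣ A ]

    -- As odds, `y` is a quotient of positive probabilities; this avoids a case split on the sign of
    -- the exponent.
    0<xγ : 0# < y
    0<xγ = begin-strict
      0#                 <⟨ /-pos (0<Pr-history (A ∷ H) B) (0<Pr-history (A ∷ H) A) ⟩
      jB * jA ⁻¹         ≈⟨ *-congʳ xγ*joint-A≈joint-B ⟨
      y * jA * jA ⁻¹     ≈⟨ x≈[x*y]*y⁻¹ y (0<Pr-history (A ∷ H) A) ⟨
      y                  ∎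

    0<1+xγ : 0# < 1# + y
    0<1+xγ = +-pos 0<1 0<xγ

    posterior-A-A : posterior A A H ≈ 1# / (1# + y)
    posterior-A-A = /-cong-cross (0<evidence A H) 0<1+xγ (begin-equality
      jA * (1# + y)
        ≈⟨ solve 2 (λ a y → a :* (con 1 :+ y) := con 1 :* (a :+ y :* a)) refl jA y ⟩
      1# * (jA + y * jA)  ≈⟨ *-congˡ (+-congˡ xγ*joint-A≈joint-B) ⟩
      1# * (jA + jB)      ∎)

    posterior-B-A : posterior B A H ≈ y / (1# + y)
    posterior-B-A = /-cong-cross (0<evidence A H) 0<1+xγ (begin-equality
      jB * (1# + y)        ≈⟨ *-congʳ xγ*joint-A≈joint-B ⟨
      y * jA * (1# + y)
        ≈⟨ solve 2 (λ a y → y :* a :* (con 1 :+ y) := y :* (a :+ y :* a)) refl jA y ⟩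
      y * (jA + y * jA)    ≈⟨ *-congˡ (+-congˡ xγ*joint-A≈joint-B) ⟩
      y * (jA + jB)        ∎)

    -- The value of `subsidy H` in the branch where it is offered, studied here for every history.
    offer : Carrier
    offer = R * ((y - 1#) / (1# + y))

    -- The fraction in `offer` is the posterior of `B` minus that of `A` under signal `A`, so adding
    -- it closes the gap exactly.
    offer-indifferent : offer + R * posterior A A H ≈ R * posterior B A H
    offer-indifferent = begin-equality
      R * ((y - 1#) * z) + R * posterior A A H  ≈⟨ +-congˡ (*-congˡ posterior-A-A) ⟩
      R * ((y - 1#) * z) + R * (1# * z)
        ≈⟨ solve 3 (λ r u z → r :* (u :* z) :+ r :* (con 1 :* z)
             := r :* ((u :+ con 1) :* z)) refl R (y - 1#) z ⟩
      R * ((y - 1# + 1#) * z)                   ≈⟨ *-congˡ (*-congʳ (x-y+y≈x y 1#)) ⟩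
      R * (y * z)                               ≈⟨ *-congˡ posterior-B-A ⟨
      R * posterior B A H                       ∎
      where
      z : Carrier
      z = (1# + y) ⁻¹

    offer≤R : offer ≤ R
    offer≤R = begin
      R * ((y - 1#) * z)    ≤⟨ *-monoʳ-≤ 0<R (inj₁ (*-monoˡ-< (⁻¹-pos 0<1+xγ) y-1<1+y)) ⟩
      R * ((1# + y) * z)    ≈⟨ *-congˡ (x*x⁻¹≈1 0<1+xγ) ⟩
      R * 1#                ≈⟨ *-identityʳ R ⟩
      R                     ∎
      where
      z : Carrier
      z = (1# + y) ⁻¹
      y-1<1+y : y - 1# < 1# + y
      y-1<1+y = begin-strict
        y - 1#       ≈⟨ +-identityʳ (y - 1#) ⟨
        y - 1# + 0#  <⟨ +-monoʳ-< (y - 1#) 0<1 ⟩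
        y - 1# + 1#  ≈⟨ x-y+y≈x y 1# ⟩
        y            ≈⟨ +-identityˡ y ⟨
        0# + y       <⟨ +-monoˡ-< y 0<1 ⟩
        1# + y       ∎

    private
      uA uB : Carrier
      uA = Pr-history[ H ∣ A ]
      uB = Pr-history[ H ∣ B ]

      0<uA*uB : 0# < uA * uB
      0<uA*uB = *-pos (0<Pr-history H A) (0<Pr-history H B)

    -- After cross-multiplication the terms `p * q * uA * uA` agree on both sides, and what remains
    -- is `q * q < p * p`. The next lemma is the mirror image.
    posterior-A-B<A-A : posterior A B H < posterior A A H
    posterior-A-B<A-A = /-mono-cross-< (0<evidence B H) (0<evidence A H) (begin-strict
      q * uA * (p * uA + q * uB)
        ≈⟨ solve 4 (λ p q u v → q :* u :* (p :* u :+ q :* v)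
             := p :* q :* u :* u :+ q :* q :* (u :* v)) refl p q uA uB ⟩
      p * q * uA * uA + q * q * (uA * uB)           <⟨ +-monoʳ-< _ (*-monoˡ-< 0<uA*uB q*q<p*p) ⟩
      p * q * uA * uA + p * p * (uA * uB)
        ≈⟨ solve 4 (λ p q u v → p :* q :* u :* u :+ p :* p :* (u :* v)
             := p :* u :* (q :* u :+ p :* v)) refl p q uA uB ⟩
      p * uA * (q * uA + p * uB)                    ∎)

    posterior-B-A<B-B : posterior B A H < posterior B B H
    posterior-B-A<B-B = /-mono-cross-< (0<evidence A H) (0<evidence B H) (begin-strict
      q * uB * (q * uA + p * uB)
        ≈⟨ solve 4 (λ p q u v → q :* v :* (q :* u :+ p :* v)
             := p :* q :* v :* v :+ q :* q :* (u :* v)) refl p q uA uB ⟩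
      p * q * uB * uB + q * q * (uA * uB)           <⟨ +-monoʳ-< _ (*-monoˡ-< 0<uA*uB q*q<p*p) ⟩
      p * q * uB * uB + p * p * (uA * uB)
        ≈⟨ solve 4 (λ p q u v → p :* q :* v :* v :+ p :* p :* (u :* v)
             := p :* v :* (p :* u :+ q :* v)) refl p q uA uB ⟩
      p * uB * (p * uA + q * uB)                    ∎)

    -- Signal `A` is exactly indifferent and so follows itself; signal `B` makes `A` less likely and
    -- `B` more likely, which tips the balance strictly to `B`.
    choose-offer : ∀ s → choose offer s H ≡ s
    choose-offer A = choose-≈ offer A H (sym offer-indifferent)
    choose-offer B = choose-> offer B H (begin-strict
      offer + R * posterior A B H  <⟨ +-monoʳ-< offer (*-monoʳ-< 0<R posterior-A-B<A-A) ⟩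
      offer + R * posterior A A H  ≈⟨ offer-indifferent ⟩
      R * posterior B A H          <⟨ *-monoʳ-< 0<R posterior-B-A<B-B ⟩
      R * posterior B B H          ∎)

  -- One round of the scheme and its cost.

  -- Where the offer is made, `choose-offer` applies. Otherwise the difference lies between -1 and
  -- 1, where unsubsidised agents follow their signals.
  choose-subsidy : ∀ H s → difference H ℤ.≤ + 1 → choose (subsidy H) s H ≡ s
  choose-subsidy H s d≤1 with offered? H
  ... | yes _   = choose-offer H s
  ... | no d≰-2 = follows s
    where
    follows : ∀ s → choose 0# s H ≡ s
    follows A = choose-unsubsidised-A H (ℤₚ.i<j⇒suc[i]≤j (ℤₚ.≰⇒> d≰-2))
    follows B = choose-unsubsidised-B H d≤1

  step-≤1 : ∀ H s → difference H ℤ.≤ + 1 → step H s ≡ s ∷ H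
  step-≤1 H s d≤1 with difference H ℤₚ.≤? + 1
  ... | yes _  = ≡.cong (_∷ H) (choose-subsidy H s d≤1)
  ... | no d≰1 = contradiction d≤1 d≰1

  step-≰1 : ∀ H s → ¬ difference H ℤ.≤ + 1 → step H s ≡ H
  step-≰1 H s d≰1 with difference H ℤₚ.≤? + 1
  ... | yes d≤1 = contradiction d≤1 d≰1
  ... | no _    = ≡.refl

  offers-≰1 : ∀ H → ¬ difference H ℤ.≤ + 1 → offers H ≡ 0
  offers-≰1 H d≰1 with offered? H
  ... | yes d≤-2 = contradiction (ℤₚ.≤-trans d≤-2 ℤ.-≤+) d≰1
  ... | no _     = ≡.refl

  ι-offers≤1 : ∀ H → ι (offers H) ≤ 1#
  ι-offers≤1 H with offered? H
  ... | yes _ = inj₂ (+-identityʳ 1#)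
  ... | no _  = inj₁ 0<1

  subsidy≤R*offers : ∀ H → subsidy H ≤ R * ι (offers H)
  subsidy≤R*offers H with offered? H
  ... | yes _ = begin
    offer H          ≤⟨ offer≤R H ⟩
    R                ≈⟨ *-identityʳ R ⟨
    R * 1#           ≈⟨ *-congˡ (+-identityʳ 1#) ⟨
    R * (1# + 0#)    ∎
  ... | no _  = inj₂ (sym (zeroʳ R))

  0≤R*ι : ∀ n → 0# ≤ R * ι n
  0≤R*ι n = begin
    0#       ≈⟨ zeroʳ R ⟨
    R * 0#   ≤⟨ *-monoʳ-≤ 0<R (0≤ι n) ⟩
    R * ι n  ∎

  paid≤R*offers : ∀ H s → paid H s ≤ R * ι (offers H)
  paid≤R*offers H s with choose (subsidy H) s H
  ... | A = subsidy≤R*offers H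
  ... | B = 0≤R*ι (offers H)

  -- Holds for every signal sequence, since a round with an offer costs at most `R` whether or not
  -- the offer is accepted; bounding the expected cost thus reduces to counting rounds.
  totalSubsidy≤R*rounds : ∀ {n} H (ss : Vec Action n) →
    totalSubsidy H ss ≤ R * ι (subsidisedRounds H ss)
  totalSubsidy≤R*rounds H []       = inj₂ (sym (zeroʳ R))
  totalSubsidy≤R*rounds H (s ∷ ss) = begin
    paid H s + totalSubsidy H′ ss
      ≤⟨ +-mono-≤ (paid≤R*offers H s) (totalSubsidy≤R*rounds H′ ss) ⟩
    R * ι (offers H) + R * ι (subsidisedRounds H′ ss)      ≈⟨ distribˡ R _ _ ⟨
    R * (ι (offers H) + ι (subsidisedRounds H′ ss))
      ≈⟨ *-congˡ (ι-+ (offers H) (subsidisedRounds H′ ss)) ⟨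
    R * ι (offers H ℕ.+ subsidisedRounds H′ ss)            ∎
    where
    H′ : History
    H′ = step H s

  -- Expectations

  𝔼-mono-≤ : ∀ n {f g} → (∀ ss → f ss ≤ g ss) → 𝔼 n f ≤ 𝔼 n g
  𝔼-mono-≤ zero    f≤g = f≤g []
  𝔼-mono-≤ (suc n) f≤g = +-mono-≤
    (*-monoʳ-≤ 0<p (𝔼-mono-≤ n (λ ss → f≤g (A ∷ ss))))
    (*-monoʳ-≤ 0<q (𝔼-mono-≤ n (λ ss → f≤g (B ∷ ss))))

  𝔼-cong : ∀ n {f g} → (∀ ss → f ss ≈ g ss) → 𝔼 n f ≈ 𝔼 n g
  𝔼-cong zero    f≈g = f≈g []
  𝔼-cong (suc n) f≈g = +-cong
    (*-congˡ (𝔼-cong n (λ ss → f≈g (A ∷ ss))))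
    (*-congˡ (𝔼-cong n (λ ss → f≈g (B ∷ ss))))

  𝔼-*ˡ : ∀ n a f → 𝔼 n (λ ss → a * f ss) ≈ a * 𝔼 n f
  𝔼-*ˡ zero    a f = refl
  𝔼-*ˡ (suc n) a f = begin-equality
    p * 𝔼 n (λ ss → a * fA ss) + q * 𝔼 n (λ ss → a * fB ss)
      ≈⟨ +-cong (*-congˡ (𝔼-*ˡ n a fA)) (*-congˡ (𝔼-*ˡ n a fB)) ⟩
    p * (a * 𝔼 n fA) + q * (a * 𝔼 n fB)
      ≈⟨ solve 5 (λ p q a u v → p :* (a :* u) :+ q :* (a :* v) := a :* (p :* u :+ q :* v)) refl p q a (𝔼 n fA) (𝔼 n fB) ⟩
    a * (p * 𝔼 n fA + q * 𝔼 n fB)  ∎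
    where
    fA fB : Vec Action n → Carrier
    fA ss = f (A ∷ ss)
    fB ss = f (B ∷ ss)

  -- The weights `p` and `q` sum to 1, so a constant passes through the average.
  average-+ : ∀ a u v → p * (a + u) + q * (a + v) ≈ a + (p * u + q * v)
  average-+ a u v = begin-equality
    p * (a + u) + q * (a + v)
      ≈⟨ solve 5 (λ p q a u v → p :* (a :+ u) :+ q :* (a :+ v)
           := (q :+ p) :* a :+ (p :* u :+ q :* v)) refl p q a u v ⟩
    (q + p) * a + (p * u + q * v)      ≈⟨ +-congʳ (*-congʳ q+p≈1) ⟩
    1# * a + (p * u + q * v)           ≈⟨ +-congʳ (*-identityˡ a) ⟩
    a + (p * u + q * v)                ∎

  𝔼-+ˡ : ∀ n a f → 𝔼 n (λ ss → a + f ss) ≈ a + 𝔼 n f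
  𝔼-+ˡ zero    a f = refl
  𝔼-+ˡ (suc n) a f = trans
    (+-cong (*-congˡ (𝔼-+ˡ n a (λ ss → f (A ∷ ss)))) (*-congˡ (𝔼-+ˡ n a (λ ss → f (B ∷ ss)))))
    (average-+ a _ _)

  -- Expected number of subsidised rounds.

  expectedRounds : ℕ → History → Carrier
  expectedRounds n H = 𝔼 n (λ ss → ι (subsidisedRounds H ss))

  -- Conditions on the first signal; the offer is fixed before that signal, so it leaves the
  -- average.
  expectedRounds-suc : ∀ n H → expectedRounds (suc n) H ≈
    ι (offers H) + (p * expectedRounds n (step H A) + q * expectedRounds n (step H B))
  expectedRounds-suc n H = trans (+-cong (*-congˡ (shift A)) (*-congˡ (shift B))) (average-+ _ _ _)
    where
    shift : ∀ s → 𝔼 n (λ ss → ι (offers H ℕ.+ subsidisedRounds (step H s) ss)) ≈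
      ι (offers H) + expectedRounds n (step H s)
    shift s = trans (𝔼-cong n (λ ss → ι-+ (offers H) (subsidisedRounds (step H s) ss)))
                    (𝔼-+ˡ n (ι (offers H)) (λ ss → ι (subsidisedRounds (step H s) ss)))

  -- Once the difference exceeds 1, no offer is made and `step` keeps the history, so this state is
  -- never left.
  expectedRounds-absorbed : ∀ n H → ¬ difference H ℤ.≤ + 1 → expectedRounds n H ≈ 0#
  expectedRounds-absorbed zero    H d≰1 = refl
  expectedRounds-absorbed (suc n) H d≰1 = begin-equality
    expectedRounds (suc n) H                                      ≈⟨ expectedRounds-suc n H ⟩
    ι (offers H) + (p * expectedRounds n (step H A) + q * expectedRounds n (step H B))
      ≈⟨ +-cong (reflexive (≡.cong ι (offers-≰1 H d≰1))) (+-cong (*-congˡ (vanishes A)) (*-congˡ (vanishes B))) ⟩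
    0# + (p * 0# + q * 0#)
      ≈⟨ solve 2 (λ p q → con 0 :+ (p :* con 0 :+ q :* con 0) := con 0) refl p q ⟩
    0#                      ∎
    where
    vanishes : ∀ s → expectedRounds n (step H s) ≈ 0#
    vanishes s = trans (reflexive (≡.cong (expectedRounds n) (step-≰1 H s d≰1)))
                       (expectedRounds-absorbed n H d≰1)

  -- Expected time for a walk with drift μ to climb k levels.
  climb : ℕ → Carrier
  climb k = ι k / μ

  -- From `suc k` levels the walk moves to `k` with probability `p` and to `suc (suc k)` with
  -- probability `q`. The levels left drop by `μ` on average, worth exactly one round after division
  -- by `μ`.
  climb-step : ∀ k → 1# + (p * climb k + q * climb (suc (suc k))) ≈ climb (suc k)
  climb-step k = begin-equality
    1# + (p * (ι k * v) + q * ((1# + (1# + ι k)) * v))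
      ≈⟨ solve 4 (λ p q v j → con 1 :+ (p :* (j :* v) :+ q :* ((con 1 :+ (con 1 :+ j)) :* v))
           := con 1 :+ q :* v :+ q :* v :+ (q :+ p) :* (j :* v)) refl p q v (ι k) ⟩
    -- The round itself is `μ * v`, which turns one `q * v` into `p * v`.
    1# + q * v + q * v + (q + p) * (ι k * v)                 ≈⟨ +-congʳ (+-congʳ 1+q*v≈p*v) ⟩
    p * v + q * v + (q + p) * (ι k * v)
      ≈⟨ solve 4 (λ p q v j → p :* v :+ q :* v :+ (q :+ p) :* (j :* v)
           := (q :+ p) :* ((con 1 :+ j) :* v)) refl p q v (ι k) ⟩
    (q + p) * ((1# + ι k) * v)                               ≈⟨ *-congʳ q+p≈1 ⟩
    1# * ((1# + ι k) * v)                                    ≈⟨ *-identityˡ _ ⟩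
    (1# + ι k) * v                                           ∎
    where
    v : Carrier
    v = μ ⁻¹
    1+q*v≈p*v : 1# + q * v ≈ p * v
    1+q*v≈p*v = begin-equality
      1# + q * v     ≈⟨ +-congʳ (x*x⁻¹≈1 0<μ) ⟨
      μ * v + q * v  ≈⟨ distribʳ v μ q ⟨
      (μ + q) * v    ≈⟨ *-congʳ μ+q≈p ⟩
      p * v          ∎

  mutual
    -- Admits `k = 0`, which a move up can reach and where both sides are 0.
    expectedRounds≤climb : ∀ n k H → difference H ℤ.+ + k ≡ + 2 → expectedRounds n H ≤ climb k
    expectedRounds≤climb n (suc k) H eq = inj₁ (expectedRounds<climb n k H eq)
    expectedRounds≤climb n zero    H eq = inj₂ (trans (expectedRounds-absorbed n H d≰1) (sym (zeroˡ (μ ⁻¹))))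
      where
      d≰1 : ¬ difference H ℤ.≤ + 1
      d≰1 d≤1 with ≡.subst (ℤ._≤ + 1) (≡.trans (≡.sym (ℤₚ.+-identityʳ (difference H))) eq) d≤1
      ... | ℤ.+≤+ (s≤s ())

    -- Induction on the horizon. Strictness starts at horizon 0, where 0 is compared with a positive
    -- climbing time.
    expectedRounds<climb : ∀ n k H → difference H ℤ.+ + suc k ≡ + 2 → expectedRounds n H < climb (suc k)
    expectedRounds<climb zero    k H eq = /-pos (0<ι-suc k) 0<μ
    expectedRounds<climb (suc n) k H eq = begin-strict
      expectedRounds (suc n) H
        ≈⟨ expectedRounds-suc n H ⟩
      ι (offers H) + (p * expectedRounds n (step H A) + q * expectedRounds n (step H B))
        ≡⟨ ≡.cong₂ (λ H₁ H₂ → ι (offers H) + (p * expectedRounds n H₁ + q * expectedRounds n H₂)) (step-≤1 H A d≤1) (step-≤1 H B d≤1) ⟩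
      ι (offers H) + (p * expectedRounds n (A ∷ H) + q * expectedRounds n (B ∷ H))
        -- A full round is charged whether or not an offer is made. The `A` branch may be absorbed
        -- and gives only `≤`; the `B` branch stays below absorption and, having positive weight
        -- `q`, carries the strictness.
        <⟨ +-mono-≤-< (ι-offers≤1 H) (+-mono-≤-<
             (*-monoʳ-≤ 0<p (expectedRounds≤climb n k (A ∷ H) eqA))
             (*-monoʳ-< 0<q (expectedRounds<climb n (suc k) (B ∷ H) eqB))) ⟩
      1# + (p * climb k + q * climb (suc (suc k)))
        ≈⟨ climb-step k ⟩
      climb (suc k)  ∎
      where
      d : ℤ
      d = difference H
      up : ∀ i j → (+ 1 ℤ.+ i) ℤ.+ j ≡ i ℤ.+ (+ 1 ℤ.+ j)
      up = solve-∀
      down : ∀ i j → (ℤ.- + 1 ℤ.+ i) ℤ.+ (+ 1 ℤ.+ j) ≡ i ℤ.+ j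
      down = solve-∀
      eqA : difference (A ∷ H) ℤ.+ + k ≡ + 2
      eqA = ≡.trans (≡.cong (ℤ._+ + k) (difference-A H)) (≡.trans (up d (+ k)) eq)
      eqB : difference (B ∷ H) ℤ.+ + suc (suc k) ≡ + 2
      eqB = ≡.trans (≡.cong (ℤ._+ + suc (suc k)) (difference-B H)) (≡.trans (down d (+ suc k)) eq)
      suc-d≤2 : ℤ.suc d ℤ.≤ + 2
      suc-d≤2 = ≡.subst (ℤ.suc d ℤ.≤_) (≡.trans (up d (+ k)) eq) (ℤₚ.i≤i+j (ℤ.suc d) (+ k))
      d≤1 : d ℤ.≤ + 1
      d≤1 = ≡.subst (ℤ._≤ + 1) (ℤₚ.pred-suc d) (ℤₚ.+-monoʳ-≤ (ℤ.- + 1) suc-d≤2)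

  expectedSubsidy≤climb : ∀ n k H → difference H ℤ.+ + k ≡ + 2 →
    𝔼 n (totalSubsidy H) ≤ R * climb k
  expectedSubsidy≤climb n k H eq = begin
    𝔼 n (totalSubsidy H)                              ≤⟨ 𝔼-mono-≤ n (totalSubsidy≤R*rounds H) ⟩
    𝔼 n (λ ss → R * ι (subsidisedRounds H ss))
      ≈⟨ 𝔼-*ˡ n R (λ ss → ι (subsidisedRounds H ss)) ⟩
    R * expectedRounds n H
      ≤⟨ *-monoʳ-≤ 0<R (expectedRounds≤climb n k H eq) ⟩
    R * climb k                                       ∎

  -- The start of the scheme

  -- Above -2 an agent with signal `A` would choose `A`.
  IncorrectCascade⇒≤-2 : ∀ H → IncorrectCascade H → difference H ℤ.≤ ℤ.- + 2
  IncorrectCascade⇒≤-2 H cascade with offered? H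
  ... | yes d≤-2 = d≤-2
  ... | no d≰-2 with ≡.trans (≡.sym (cascade A)) (choose-unsubsidised-A H (ℤₚ.i<j⇒suc[i]≤j (ℤₚ.≰⇒> d≰-2)))
  ... | ()

  -- At -2 or below even signal `A` leaves `B` more likely. The unsubsidised history therefore stops
  -- growing there.
  FollowsSignal⇒≰-2 : ∀ H → FollowsSignal 0# H → ¬ difference H ℤ.≤ ℤ.- + 2
  FollowsSignal⇒≰-2 H (followsA , _) d≤-2
    with ≡.trans (≡.sym followsA) (choose-unsubsidised-<0 A H d′<0)
    where
    d′<0 : difference (A ∷ H) ℤ.< + 0
    d′<0 = ≡.subst (ℤ._< + 0) (≡.sym (difference-A H))
      (ℤₚ.≤-<-trans (ℤₚ.+-monoʳ-≤ (+ 1) d≤-2) ℤ.-<+)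
  ... | ()

  difference-∷ : ∀ a H → ℤ.pred (difference H) ℤ.≤ difference (a ∷ H)
  difference-∷ A H = ≡.subst (ℤ.pred (difference H) ℤ.≤_) (≡.sym (difference-A H))
    (ℤₚ.+-monoˡ-≤ (difference H) ℤ.-≤+)
  difference-∷ B H = ℤₚ.≤-reflexive (≡.sym (difference-B H))

  -- The history grows only from a difference of at least -1, and one choice lowers it by at most 1.
  -2≤stepUnsubsidised : ∀ H s → ℤ.- + 2 ℤ.≤ difference H → ℤ.- + 2 ℤ.≤ difference (stepUnsubsidised H s)
  -2≤stepUnsubsidised H s -2≤d with followsSignal? 0# H
  ... | no _        = -2≤d
  ... | yes follows = ℤₚ.≤-trans
    (ℤₚ.+-monoʳ-≤ (ℤ.- + 1) (ℤₚ.i<j⇒suc[i]≤j (ℤₚ.≰⇒> (FollowsSignal⇒≰-2 H follows))))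
    (difference-∷ (choose 0# s H) H)

  -2≤foldl-stepUnsubsidised : ∀ {n} H (ss : Vec Action n) → ℤ.- + 2 ℤ.≤ difference H →
    ℤ.- + 2 ℤ.≤ difference (Vec.foldl (λ _ → History) stepUnsubsidised H ss)
  -2≤foldl-stepUnsubsidised H []       -2≤d = -2≤d
  -2≤foldl-stepUnsubsidised H (s ∷ ss) -2≤d =
    -2≤foldl-stepUnsubsidised (stepUnsubsidised H s) ss (-2≤stepUnsubsidised H s -2≤d)

  -- The exact value fixes the number of levels to climb, and with it the constant 4 in the bound.
  difference-at-cascade : ∀ {n} (past : Vec Action n) → IncorrectCascade (unsubsidised past) →
    difference (unsubsidised past) ≡ ℤ.- + 2
  difference-at-cascade past cascade = ℤₚ.≤-antisym
    (IncorrectCascade⇒≤-2 (unsubsidised past) cascade)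
    (-2≤foldl-stepUnsubsidised [] past ℤ.-≤+)

theorem6p3p2 : ∀ {c ℓ₁ ℓ₂} (F : OrderedField c ℓ₁ ℓ₂) →
    let open OrderedField F in
    (p R : Carrier) → 1# / ι 2 < p → p < 1# → 0# < R →
    let open Cascade F p R
        bound = ι 4 / (ι 2 * p - 1#) in
    (T t : ℕ) (past : Vec Action t) →
    bound < ι T - ι (suc t) →
    IncorrectCascade (unsubsidised past) →
    (𝔼 (T ∸ t) (λ ss → ι (subsidisedRounds (unsubsidised past) ss)) < bound)
    × (𝔼 (T ∸ t) (λ ss → totalSubsidy (unsubsidised past) ss) ≤ R * bound)
theorem6p3p2 F p R ½<p p<1 0<R T t past _ cascade =
    -- From -2 to 2 there are four levels; the strict bound is stated for `suc k`, hence 3 here and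
    -- 4 below.
    expectedRounds<climb (T ∸ t) 3 (unsubsidised past) start
  , expectedSubsidy≤climb (T ∸ t) 4 (unsubsidised past) start
  where
  open Cascade F p R
  open CascadeProperties F p R ½<p p<1 0<R
  start : difference (unsubsidised past) ℤ.+ + 4 ≡ + 2
  start = ≡.cong (ℤ._+ + 4) (difference-at-cascade past cascade)
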